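{- Let $\mathbf{G}$ be a finite set of generalized path conditions and let $\sigma$ be a sequent. If $\sigma$ is valid over the class of $\mathbf{G}$-frames, then $\mathrm{NCL}_{\mathbf{G}}\vdash\sigma$ (i.e. $\sigma$ has a proof in the labelled sequent calculus $\mathrm{NCL}_{\mathbf{G}}$).
   Context: **Formulae and semantics.** Formulae are generated by $\varphi ::= \bot \mid p \mid (\varphi\to\varphi)\mid \triangle\varphi$, with $p$ in a countably infinite set $\mathsf{Prop}$ ($\triangle$ is the non-contingency operator). A frame is a pair $(W,R)$ with $W\neq\emptyset$ and $R\subseteq W\times W$. A model is $\mathcal{M}=(W,R,V)$ with $(W,R)$ a frame and $V:W\to 2^{\mathsf{Prop}}$. Truth $\mathcal{M},w\models\varphi$ is standard for $\bot$, atoms ($\mathcal{M},w\models p$ iff $p\in V(w)$) and $\to$; and $\mathcal{M},w\models\triangle\varphi$ iff either $\mathcal{M},v\models\varphi$ for all $v$ with $wRv$, or $\mathcal{M},v\not\models\varphi$ for all $v$ with $wRv$. **Words and generalized path conditions (GPCs).** Let $\Sigma=\{x,\overline{x}\}$ and let $\Sigma^*$ be the set of finite words over $\Sigma$, with empty word $\epsilon$. Converse: $\epsilon^{ -1}=\epsilon$, $x^{ -1}=\overline{x}$, $\overline{x}^{ -1}=x$, $(z_1\cdots z_n)^{ -1}=z_n^{ -1}\cdots z_1^{ -1}$. For a set $X$ (possibly empty) and $Q\subseteq X\times X$: $Q_\epsilon=\{(a,a)\mid a\in X\}$, $Q_x=Q$, $Q_{\overline{x}}=Q^{ -1}$, and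 $(a,b)\in Q_{z_1\cdots z_n}$ iff there are $a=a_0,\dots,a_n=b$ in $X$ with $(a_{i-1},a_i)\in Q_{z_i}$ for all $1\le i\le n$. A $\Sigma$-system $\mathcal{S}$ is a set of productions $z\mapsto\beta$ with $z\in\Sigma$, $\beta\in\Sigma^*$; $\rho z\tau\mapsto_{\mathcal{S}}\rho\eta\tau$ whenever $z\mapsto\eta\in\mathcal{S}$ and $\rho,\tau\in\Sigma^*$; $\mapsto_{\mathcal{S}}^*$ is the reflexive transitive closure; $\mathcal{L}_{\mathcal{S}}(\beta)=\{\gamma\mid\beta\mapsto^*_{\mathcal{S}}\gamma\}$. For $\alpha\in\Sigma^*$, $\mathcal{S}_\alpha=\{x\mapsto\alpha,\ \overline{x}\mapsto\alpha^{ -1}\}$. A frame $(W,R)$ satisfies the GPC $\mathbf{G}(\alpha)$ if $R_\beta\subseteq R$ for every $\beta\in\mathcal{L}_{\mathcal{S}_\alpha}(x)$. For a finite set $\mathbf{G}$ of GPCs, a $\mathbf{G}$-frame is a frame satisfying every member of $\mathbf{G}$, and $\mathcal{S}(\mathbf{G})=\bigcup_{\mathbf{G}(\alpha)\in\mathbf{G}}\mathcal{S}_\alpha$. **Sequents.** Let $\mathsf{Var}$ be a countably infinite set of variables (labels). A relational atom is an expression $\mathsf{x}\,\mathsf{R}\,\mathsf{y}$ and a labelled formula is an expression $\mathsf{x}:\varphi$, with $\mathsf{x},\mathsf{y}\in\mathsf{Var}$ and $\varphi$ a formula. A sequent $\sigma=\Omega\dashv\Gamma\Rightarrow\Delta$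 consists of a finite set $\Omega$ of relational atoms (the control) and finite sets $\Gamma,\Delta$ of labelled formulae. $\mathsf{Var}(\sigma)$ is the set of variables occurring in $\sigma$. For a model $\mathcal{M}=(W,R,V)$ and an assignment $\lambda:\mathsf{Var}\to W$: $\mathcal{M},\lambda\Vdash\mathsf{x}\,\mathsf{R}\,\mathsf{y}$ iff $\lambda(\mathsf{x})R\lambda(\mathsf{y})$; $\mathcal{M},\lambda\Vdash\mathsf{x}:\varphi$ iff $\mathcal{M},\lambda(\mathsf{x})\models\varphi$; and $\mathcal{M},\lambda\Vdash\sigma$ iff, whenever all members of $\Omega$ and all members of $\Gamma$ hold under $\mathcal{M},\lambda$, some member of $\Delta$ holds under $\mathcal{M},\lambda$. $\sigma$ is valid over a class of frames if $\mathcal{M},\lambda\Vdash\sigma$ for every model $\mathcal{M}$ based on a frame in the class and every assignment $\lambda$. **Closure of controls.** For $\sigma=\Omega\dashv\Gamma\Rightarrow\Delta$ put $X=\mathsf{Var}(\sigma)$ and $Q=\{(\mathsf{x},\mathsf{y})\mid \mathsf{x}\,\mathsf{R}\,\mathsf{y}\in\Omega\}\subseteq X\times X$. Then $\mathcal{S}(\mathbf{G})(\Omega)$ is the set of relational atoms $\mathsf{x}\,\mathsf{R}\,\mathsf{y}$ with $(\mathsf{x},\mathsf{y})\in\bigcup_{\beta\in\mathcal{L}_{\mathcal{S}(\mathbf{G})}(x)}Q_\beta$ (computed over the domain $X$). **The calculus $\mathrm{NCL}_{\mathbf{G}}$.** Commas denote set union. Initial sequents: $\Omega\dashv\Gamma,\mathsf{x}:\bot\Rightarrow\Delta$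 and $\Omega\dashv\Gamma,\mathsf{x}:\varphi\Rightarrow\mathsf{x}:\varphi,\Delta$. Rules (premises / conclusion): - ${\to}\mathsf{L}$: from $\Omega\dashv\Gamma\Rightarrow\mathsf{x}:\varphi,\Delta$ and $\Omega\dashv\Gamma,\mathsf{x}:\psi\Rightarrow\Delta$ infer $\Omega\dashv\Gamma,\mathsf{x}:\varphi\to\psi\Rightarrow\Delta$. - ${\to}\mathsf{R}$: from $\Omega\dashv\Gamma,\mathsf{x}:\varphi\Rightarrow\mathsf{x}:\psi,\Delta$ infer $\Omega\dashv\Gamma\Rightarrow\mathsf{x}:\varphi\to\psi,\Delta$. - $\triangle\mathsf{L}$: from $\Omega\dashv\Gamma,\mathsf{x}:\triangle\varphi,\{\mathsf{y}:\varphi\mid\mathsf{x}\,\mathsf{R}\,\mathsf{y}\in\Omega\}\Rightarrow\Delta$ and $\Omega\dashv\Gamma,\mathsf{x}:\triangle\varphi\Rightarrow\{\mathsf{y}:\varphi\mid\mathsf{x}\,\mathsf{R}\,\mathsf{y}\in\Omega\},\Delta$ infer $\Omega\dashv\Gamma,\mathsf{x}:\triangle\varphi\Rightarrow\Delta$. - $\triangle\mathsf{R}$: from $\Omega,\mathsf{x}\,\mathsf{R}\,\mathsf{y},\mathsf{x}\,\mathsf{R}\,\mathsf{z}\dashv\Gamma,\mathsf{y}:\varphi\Rightarrow\mathsf{z}:\varphi,\mathsf{x}:\triangle\varphi,\Delta$ infer $\Omega\dashv\Gamma\Rightarrow\mathsf{x}:\triangle\varphi,\Delta$, provided $\mathsf{y}\neq\mathsf{z}$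 and neither $\mathsf{y}$ nor $\mathsf{z}$ occurs in the conclusion. - $\mathsf{r}_{\mathbf{G}}$: from $\mathcal{S}(\mathbf{G})(\Omega)\dashv\Gamma\Rightarrow\Delta$ infer $\Omega\dashv\Gamma\Rightarrow\Delta$ (closure computed over the variables of the conclusion). A proof of $\sigma$ in $\mathrm{NCL}_{\mathbf{G}}$ is a finite tree labelled by sequents according to the rules, with root labelled $\sigma$ and every leaf labelled by an initial sequent. -}

module Defs where

open import Data.Empty using (⊥)
open import Data.List.Base using (List; []; _∷_; [_]; _++_; map; concatMap; filter; reverse)
open import Data.List.Membership.Propositional using (_∈_; _∉_)
open import Data.List.Relation.Binary.BagAndSetEquality using (_∼[_]_; set)
open import Data.List.Relation.Unary.All using (All)
open import Data.List.Relation.Unary.Any using (Any)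
open import Data.Nat.Base using (ℕ)
open import Data.Nat.Properties using (_≟_)
open import Data.Product.Base using (∃; _×_)
open import Data.Sum.Base using (_⊎_)
open import Function.Bundles using (_⇔_)
open import Level using (Level; 0ℓ; suc; _⊔_)
open import Relation.Binary.Construct.Closure.ReflexiveTransitive using (Star)
open import Relation.Binary.Core using (Rel; _⇒_)
open import Relation.Binary.PropositionalEquality.Core using (_≢_)
open import Relation.Nullary.Negation.Core using (¬_)
open import Relation.Unary using (Pred; U)

-- Formulae and semantics

Atom : Set
Atom = ℕ

infixr 20 _⇾_
infix  30 △_

data Formula : Set where
  ⊥ᶠ   : Formula
  atom : Atom → Formula
  _⇾_  : Formula → Formula → Formula
  △_   : Formula → Formula

record Frame : Set₁ where
  field
    W        : Set
    nonempty : W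
    R        : Rel W 0ℓ

record Model : Set₁ where
  field
    frame : Frame
  open Frame frame public
  field
    V : W → Pred Atom 0ℓ

-- The connectives are read in the meta-logic, so this is the usual two-valued
-- truth definition only in the presence of excluded middle.

infix 4 _,_⊨_

_,_⊨_ : (M : Model) → Model.W M → Formula → Set
M , w ⊨ ⊥ᶠ      = ⊥
M , w ⊨ atom p  = Model.V M w p
M , w ⊨ (φ ⇾ ψ) = M , w ⊨ φ → M , w ⊨ ψ
M , w ⊨ (△ φ)   = (∀ v → Model.R M w v → M , v ⊨ φ)
                ⊎ (∀ v → Model.R M w v → ¬ (M , v ⊨ φ))

-- Words over Σ = {x, x̄}; here fwd is x and bwd is x̄.

data Letter : Set where
  fwd bwd : Letter

Word : Set
Word = List Letter

converseLetter : Letter → Letter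
converseLetter fwd = bwd
converseLetter bwd = fwd

infix 25 _⁻¹

_⁻¹ : Word → Word
β ⁻¹ = reverse (map converseLetter β)

module _ {a ℓ : Level} {A : Set a} where

  StepAlong : Rel A ℓ → Letter → Rel A ℓ
  StepAlong Q fwd a b = Q a b
  StepAlong Q bwd a b = Q b a

  -- PathAlong X Q β is the relation Q_β computed over the domain X ⊆ A: all
  -- points of the path, including its two ends, lie in X.  In particular,
  -- Q_ε is the diagonal of X.

  data PathAlong (X : Pred A ℓ) (Q : Rel A ℓ) : Word → Rel A (a ⊔ ℓ) where
    nil  : ∀ {a} → X a → PathAlong X Q [] a a
    cons : ∀ {z β a b c} → X a → StepAlong Q z a b → PathAlong X Q β b c →
           PathAlong X Q (z ∷ β) a c

-- Σ-systems: S z β says that the production z ↦ β belongs to S.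

System : Set₁
System = Letter → Word → Set

data Rewrite (S : System) : Rel Word 0ℓ where
  rewrite-at : ∀ ρ {z η} τ → S z η → Rewrite S (ρ ++ [ z ] ++ τ) (ρ ++ η ++ τ)

Language : System → Word → Pred Word 0ℓ
Language S β γ = Star (Rewrite S) β γ

data Productions (α : Word) : System where
  prod-fwd : Productions α fwd α
  prod-bwd : Productions α bwd (α ⁻¹)

-- Generalized path conditions

record GPC : Set where
  constructor 𝐆
  field
    word : Word

open GPC public

Satisfies : Frame → GPC → Set
Satisfies F (𝐆 α) = ∀ β → Language (Productions α) [ fwd ] β → PathAlong U R β ⇒ R
  where open Frame F

GFrame : List GPC → Pred Frame 0ℓ
GFrame 𝔾 F = All (Satisfies F) 𝔾

SystemOf : List GPC → System
SystemOf 𝔾 z β = ∃ λ g → g ∈ 𝔾 × Productions (word g) z β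

-- Sequents.  Finite sets are represented by lists, considered up to having the
-- same elements; _≋_ below is the resulting equality of sequents.

Var : Set
Var = ℕ

infix 15 _𝖱_
infix 15 _∶_

record RelAtom : Set where
  constructor _𝖱_
  field
    source target : Var

record LFormula : Set where
  constructor _∶_
  field
    label   : Var
    formula : Formula

infix 4.5 _⊣_⇒ˢ_

record Sequent : Set where
  constructor _⊣_⇒ˢ_
  field
    control    : List RelAtom
    antecedent : List LFormula
    succedent  : List LFormula

infix 4 _≋_

_≋_ : Rel Sequent 0ℓ
(Ω ⊣ Γ ⇒ˢ Δ) ≋ (Ω′ ⊣ Γ′ ⇒ˢ Δ′) = Ω ∼[ set ] Ω′ × Γ ∼[ set ] Γ′ × Δ ∼[ set ] Δ′

vars : Sequent → List Var
vars (Ω ⊣ Γ ⇒ˢ Δ) =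
  concatMap (λ { (u 𝖱 v) → u ∷ v ∷ [] }) Ω
    ++ map LFormula.label Γ ++ map LFormula.label Δ

Assignment : Model → Set
Assignment M = Var → Model.W M

module _ (M : Model) (ƛ : Assignment M) where

  HoldsAtom : Pred RelAtom 0ℓ
  HoldsAtom (u 𝖱 v) = Model.R M (ƛ u) (ƛ v)

  HoldsFormula : Pred LFormula 0ℓ
  HoldsFormula (u ∶ φ) = M , ƛ u ⊨ φ

  HoldsSequent : Pred Sequent 0ℓ
  HoldsSequent (Ω ⊣ Γ ⇒ˢ Δ) =
    All HoldsAtom Ω → All HoldsFormula Γ → Any HoldsFormula Δ

ValidOver : ∀ {ℓ} → Pred Frame ℓ → Sequent → Set (suc 0ℓ ⊔ ℓ)
ValidOver 𝒞 σ = (M : Model) → 𝒞 (Model.frame M) → (ƛ : Assignment M) → HoldsSequent M ƛ σ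

-- Closure 𝔾 σ is the set 𝒮(𝐆)(Ω), where Ω is the control of σ, computed over
-- the domain Var(σ).

Closure : List GPC → Sequent → Pred RelAtom 0ℓ
Closure 𝔾 σ (u 𝖱 v) =
  ∃ λ β → Language (SystemOf 𝔾) [ fwd ] β
        × PathAlong (_∈ vars σ) (λ u′ v′ → (u′ 𝖱 v′) ∈ Sequent.control σ) β u v

-- { y ∶ φ ∣ x 𝖱 y ∈ Ω }

successors : Var → List RelAtom → List Var
successors x Ω = map RelAtom.target (filter (λ r → RelAtom.source r ≟ x) Ω)

atSuccessors : Var → Formula → List RelAtom → List LFormula
atSuccessors x φ Ω = map (_∶ φ) (successors x Ω)

-- The calculus.  The constructor ≋-resp identifies sequents whose lists
-- represent the same sets; since the side formulae of a rule may already contain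
-- the principal formula, the commas of the rules are thereby set unions.  In r𝐆
-- the list Ω⁺ is any enumeration of the closed control.

infix 4 NCL[_]⊢_

data NCL[_]⊢_ (𝔾 : List GPC) : Pred Sequent 0ℓ where

  ≋-resp : ∀ {σ τ} → σ ≋ τ → NCL[ 𝔾 ]⊢ σ → NCL[ 𝔾 ]⊢ τ

  init⊥ : ∀ {Ω Γ Δ x} → NCL[ 𝔾 ]⊢ Ω ⊣ (x ∶ ⊥ᶠ) ∷ Γ ⇒ˢ Δ

  init : ∀ {Ω Γ Δ x φ} → NCL[ 𝔾 ]⊢ Ω ⊣ (x ∶ φ) ∷ Γ ⇒ˢ (x ∶ φ) ∷ Δ

  ⇾L : ∀ {Ω Γ Δ x φ ψ} →
       NCL[ 𝔾 ]⊢ Ω ⊣ Γ ⇒ˢ (x ∶ φ) ∷ Δ →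
       NCL[ 𝔾 ]⊢ Ω ⊣ (x ∶ ψ) ∷ Γ ⇒ˢ Δ →
       NCL[ 𝔾 ]⊢ Ω ⊣ (x ∶ φ ⇾ ψ) ∷ Γ ⇒ˢ Δ

  ⇾R : ∀ {Ω Γ Δ x φ ψ} →
       NCL[ 𝔾 ]⊢ Ω ⊣ (x ∶ φ) ∷ Γ ⇒ˢ (x ∶ ψ) ∷ Δ →
       NCL[ 𝔾 ]⊢ Ω ⊣ Γ ⇒ˢ (x ∶ φ ⇾ ψ) ∷ Δ

  △L : ∀ {Ω Γ Δ x φ} →
       NCL[ 𝔾 ]⊢ Ω ⊣ atSuccessors x φ Ω ++ (x ∶ △ φ) ∷ Γ ⇒ˢ Δ →
       NCL[ 𝔾 ]⊢ Ω ⊣ (x ∶ △ φ) ∷ Γ ⇒ˢ atSuccessors x φ Ω ++ Δ →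
       NCL[ 𝔾 ]⊢ Ω ⊣ (x ∶ △ φ) ∷ Γ ⇒ˢ Δ

  △R : ∀ {Ω Γ Δ x y z φ} →
       y ≢ z →
       y ∉ vars (Ω ⊣ Γ ⇒ˢ (x ∶ △ φ) ∷ Δ) →
       z ∉ vars (Ω ⊣ Γ ⇒ˢ (x ∶ △ φ) ∷ Δ) →
       NCL[ 𝔾 ]⊢ (x 𝖱 y) ∷ (x 𝖱 z) ∷ Ω ⊣ (y ∶ φ) ∷ Γ ⇒ˢ (z ∶ φ) ∷ (x ∶ △ φ) ∷ Δ →
       NCL[ 𝔾 ]⊢ Ω ⊣ Γ ⇒ˢ (x ∶ △ φ) ∷ Δ

  r𝐆 : ∀ {Ω Ω⁺ Γ Δ} →
       (∀ r → r ∈ Ω⁺ ⇔ Closure 𝔾 (Ω ⊣ Γ ⇒ˢ Δ) r) →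
       NCL[ 𝔾 ]⊢ Ω⁺ ⊣ Γ ⇒ˢ Δ →
       NCL[ 𝔾 ]⊢ Ω ⊣ Γ ⇒ˢ Δ

{-# OPTIONS --safe #-}
module Submission where

-- An unprovable sequent always has an unprovable premise above it in which any
-- given formula, or the closure of the control, has been treated; since commas
-- are set unions, each such premise extends the conclusion.  Treating everything
-- in the current sequent at each stage gives an infinite increasing chain of
-- unprovable sequents.  Its limit is a countermodel on the variables occurring in
-- it: the path of a word is finite, hence already present at some finite stage,
-- and the closure taken at that stage contains the atom required by the GPCs.

open import Defs
open import Axiom.ExcludedMiddle using (ExcludedMiddle)
open import Data.List.Base using (List; []; _∷_; [_]; _++_; map; filter; cartesianProductWith)
open import Data.List.Extrema.Nat using (max; xs≤max)
open import Data.List.Membership.Propositional using (_∈_; _∉_; find; lose)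
open import Data.List.Membership.Propositional.Properties
  using (∈-map⁺; ∈-++⁺ˡ; ∈-++⁺ʳ; ∈-concatMap⁺; ∈-filter⁺; ∈-filter⁻; ∈-cartesianProductWith⁺)
open import Data.List.Relation.Binary.Subset.Propositional using (_⊆_)
open import Data.List.Relation.Binary.Subset.Propositional.Properties
  using (map⁺; ++⁺; concatMap⁺; ∈-∷⁺ʳ)
open import Data.List.Relation.Unary.All as All using (All; []; _∷_; tabulate; lookup)
open import Data.List.Relation.Unary.Any using (here; there)
open import Data.Nat.Base using (ℕ; zero; suc; _≤_; _⊔_; _≤′_; ≤′-refl; ≤′-step)
open import Data.Nat.Properties
  using (1+n≰n; 1+n≢n; ≤-refl; ≤-trans; n≤1+n; ≤⇒≤′; m≤m⊔n; m≤n⊔m)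
open import Data.Product.Base using (∃; ∃₂; _×_; _,_; proj₁; proj₂)
open import Data.Sum.Base as Sum using (_⊎_; inj₁; inj₂)
open import Data.Unit.Base using (⊤; tt)
open import Function.Base using (id; _∘_; case_of_)
open import Function.Bundles using (_⇔_; mk⇔; Equivalence)
open import Level using (0ℓ)
open import Relation.Binary.Construct.Closure.ReflexiveTransitive as Star using (ε)
open import Relation.Binary.Core using (Rel; _⇒_)
open import Relation.Binary.PropositionalEquality using (refl; sym)
open import Relation.Nullary using (Dec; yes; no; ¬_; contradiction)
open import Relation.Nullary.Decidable using (decidable-stable)
open import Relation.Unary using (Pred; U)

open Sequent

-- Inclusion of sequents and closures of controls.

infix 4 _⊑_

record _⊑_ (σ τ : Sequent) : Set where
  constructor ⟨_,_,_⟩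
  field
    control-⊆    : control σ ⊆ control τ
    antecedent-⊆ : antecedent σ ⊆ antecedent τ
    succedent-⊆  : succedent σ ⊆ succedent τ

open _⊑_

⊑-refl : ∀ {σ} → σ ⊑ σ
⊑-refl = ⟨ id , id , id ⟩

⊑-trans : ∀ {ρ σ τ} → ρ ⊑ σ → σ ⊑ τ → ρ ⊑ τ
⊑-trans ⟨ a , b , c ⟩ ⟨ a′ , b′ , c′ ⟩ = ⟨ a′ ∘ a , b′ ∘ b , c′ ∘ c ⟩

vars-mono : ∀ {σ τ} → σ ⊑ τ → vars σ ⊆ vars τ
vars-mono ⟨ Ω⊆ , Γ⊆ , Δ⊆ ⟩ = ++⁺ (concatMap⁺ _ Ω⊆) (++⁺ (map⁺ _ Γ⊆) (map⁺ _ Δ⊆))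

source∈vars : ∀ {x y} σ → (x 𝖱 y) ∈ control σ → x ∈ vars σ
source∈vars σ r∈Ω = ∈-++⁺ˡ (∈-concatMap⁺ _ (lose r∈Ω (here refl)))

target∈vars : ∀ {x y} σ → (x 𝖱 y) ∈ control σ → y ∈ vars σ
target∈vars σ r∈Ω = ∈-++⁺ˡ (∈-concatMap⁺ _ (lose r∈Ω (there (here refl))))

antecedent∈vars : ∀ {x φ} σ → (x ∶ φ) ∈ antecedent σ → x ∈ vars σ
antecedent∈vars {x} {φ} σ f∈Γ =
  vars-mono {[] ⊣ [ x ∶ φ ] ⇒ˢ []} {σ} ⟨ (λ ()) , ∈-∷⁺ʳ f∈Γ (λ ()) , (λ ()) ⟩ (here refl)

atSuccessors⁺ : ∀ {x y φ Ω} → (x 𝖱 y) ∈ Ω → (y ∶ φ) ∈ atSuccessors x φ Ω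
atSuccessors⁺ r∈Ω = ∈-map⁺ _ (∈-map⁺ _ (∈-filter⁺ _ r∈Ω refl))

path-map : ∀ {X X′ : Pred Var 0ℓ} {Q Q′ : Rel Var 0ℓ} →
           (∀ {a} → X a → X′ a) → Q ⇒ Q′ →
           ∀ {β} → PathAlong X Q β ⇒ PathAlong X′ Q′ β
path-map f g (nil a∈X)                = nil (f a∈X)
path-map f g (cons {z = fwd} a∈X s p) = cons (f a∈X) (g s) (path-map f g p)
path-map f g (cons {z = bwd} a∈X s p) = cons (f a∈X) (g s) (path-map f g p)

path-source : ∀ {X : Pred Var 0ℓ} {Q β a b} → PathAlong X Q β a b → X a
path-source (nil a∈X)      = a∈X
path-source (cons a∈X _ _) = a∈X

path-target : ∀ {X : Pred Var 0ℓ} {Q β a b} → PathAlong X Q β a b → X b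
path-target (nil a∈X)    = a∈X
path-target (cons _ _ p) = path-target p

language-𝔾 : ∀ {𝔾 g} → g ∈ 𝔾 → ∀ {γ β} →
             Language (Productions (word g)) γ β → Language (SystemOf 𝔾) γ β
language-𝔾 g∈𝔾 = Star.map λ { (rewrite-at ρ τ p) → rewrite-at ρ τ (_ , g∈𝔾 , p) }

closure-mono : ∀ {𝔾 σ τ r} → σ ⊑ τ → Closure 𝔾 σ r → Closure 𝔾 τ r
closure-mono σ⊑τ (β , β∈L , p) = β , β∈L , path-map (vars-mono σ⊑τ) (control-⊆ σ⊑τ) p

closure-⊇ : ∀ {𝔾} σ {r} → r ∈ control σ → Closure 𝔾 σ r
closure-⊇ σ r∈Ω =
  [ fwd ] , ε , cons (source∈vars σ r∈Ω) r∈Ω (nil (target∈vars σ r∈Ω))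

∷-absorb : ∀ {A : Set} {a : A} {as} → a ∈ as → ∀ {x} → (x ∈ a ∷ as) ⇔ (x ∈ as)
∷-absorb a∈as = mk⇔ (∈-∷⁺ʳ a∈as id) there

-- Contraction and fresh variables.

module _ {𝔾 : List GPC} where

  -- Lists count as sets, so a rule can act on a formula anywhere in `Γ` while a copy of it stays in
  -- the premise.
  contractL : ∀ {Ω Γ Δ f} → f ∈ Γ → NCL[ 𝔾 ]⊢ Ω ⊣ f ∷ Γ ⇒ˢ Δ → NCL[ 𝔾 ]⊢ Ω ⊣ Γ ⇒ˢ Δ
  contractL f∈Γ = ≋-resp (mk⇔ id id , ∷-absorb f∈Γ , mk⇔ id id)

  contractR : ∀ {Ω Γ Δ f} → f ∈ Δ → NCL[ 𝔾 ]⊢ Ω ⊣ Γ ⇒ˢ f ∷ Δ → NCL[ 𝔾 ]⊢ Ω ⊣ Γ ⇒ˢ Δ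
  contractR f∈Δ = ≋-resp (mk⇔ id id , mk⇔ id id , ∷-absorb f∈Δ)

∉-above-max : ∀ {xs n} → suc (max 0 xs) ≤ n → n ∉ xs
∉-above-max max<n n∈xs = 1+n≰n (≤-trans max<n (lookup (xs≤max 0 _) n∈xs))

-- Unprovable extensions in which tasks are done.

module _ (em : ExcludedMiddle 0ℓ) (𝔾 : List GPC) where

  Unprovable : Pred Sequent 0ℓ
  Unprovable σ = ¬ NCL[ 𝔾 ]⊢ σ

  data Task : Set where
    close      : Task
    left right : LFormula → Task

  -- Successors are read off the earlier `σ`, since `△L` reaches only the atoms present when it is
  -- applied; later ones need a new application.
  DoneL : LFormula → Rel Sequent 0ℓ
  DoneL (x ∶ ⊥ᶠ)      σ τ = ⊤
  DoneL (x ∶ atom p)  σ τ = ⊤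
  DoneL (x ∶ (φ ⇾ ψ)) σ τ = (x ∶ φ) ∈ succedent τ ⊎ (x ∶ ψ) ∈ antecedent τ
  DoneL (x ∶ (△ φ))   σ τ = (∀ {v} → (x 𝖱 v) ∈ control σ → (v ∶ φ) ∈ antecedent τ)
                          ⊎ (∀ {v} → (x 𝖱 v) ∈ control σ → (v ∶ φ) ∈ succedent τ)

  DoneR : LFormula → Pred Sequent 0ℓ
  DoneR (x ∶ ⊥ᶠ)      τ = ⊤
  DoneR (x ∶ atom p)  τ = ⊤
  DoneR (x ∶ (φ ⇾ ψ)) τ = (x ∶ φ) ∈ antecedent τ × (x ∶ ψ) ∈ succedent τ
  DoneR (x ∶ (△ φ))   τ = ∃₂ λ y z → ((x 𝖱 y) ∈ control τ × (y ∶ φ) ∈ antecedent τ)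
                                   × ((x 𝖱 z) ∈ control τ × (z ∶ φ) ∈ succedent τ)

  -- Only what is already present in σ is to be treated in τ, so Done is antitone
  -- in σ and tasks can be carried out one after the other.
  Done : Task → Rel Sequent 0ℓ
  Done close     σ τ = ∀ {r} → Closure 𝔾 σ r → r ∈ control τ
  Done (left f)  σ τ = f ∈ antecedent σ → DoneL f σ τ
  Done (right f) σ τ = f ∈ succedent σ → DoneR f τ

  Done-mono : ∀ t {σ σ′ τ τ′} → σ′ ⊑ σ → τ ⊑ τ′ → Done t σ τ → Done t σ′ τ′
  Done-mono close p q d c = control-⊆ q (d (closure-mono p c))
  Done-mono (left (x ∶ ⊥ᶠ)) p q d f∈Γ = tt
  Done-mono (left (x ∶ atom _)) p q d f∈Γ = tt
  Done-mono (left (x ∶ (φ ⇾ ψ))) p q d f∈Γ =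
    Sum.map (succedent-⊆ q) (antecedent-⊆ q) (d (antecedent-⊆ p f∈Γ))
  Done-mono (left (x ∶ (△ φ))) p q d f∈Γ =
    Sum.map (λ h r∈Ω → antecedent-⊆ q (h (control-⊆ p r∈Ω)))
            (λ h r∈Ω → succedent-⊆ q (h (control-⊆ p r∈Ω)))
            (d (antecedent-⊆ p f∈Γ))
  Done-mono (right (x ∶ ⊥ᶠ)) p q d f∈Δ = tt
  Done-mono (right (x ∶ atom _)) p q d f∈Δ = tt
  Done-mono (right (x ∶ (φ ⇾ ψ))) p q d f∈Δ with d (succedent-⊆ p f∈Δ)
  ... | φ∈Γ , ψ∈Δ = antecedent-⊆ q φ∈Γ , succedent-⊆ q ψ∈Δ
  Done-mono (right (x ∶ (△ φ))) p q d f∈Δ with d (succedent-⊆ p f∈Δ)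
  ... | y , z , (xRy , y∈Γ) , (xRz , z∈Δ) =
    y , z , (control-⊆ q xRy , antecedent-⊆ q y∈Γ) , (control-⊆ q xRz , succedent-⊆ q z∈Δ)

  Extension : Sequent → (Sequent → Set) → Set
  Extension σ P = ∃ λ τ → Unprovable τ × σ ⊑ τ × P τ

  -- Both ends of a path lie in `vars σ`, so there are finitely many candidate atoms; excluded
  -- middle, rather than an algorithm for the language, decides which to keep.
  closedControl : ∀ σ → ∃ λ Ω⁺ → ∀ r → r ∈ Ω⁺ ⇔ Closure 𝔾 σ r
  closedControl σ =
    filter closed? candidates ,
    λ r → mk⇔ (λ r∈Ω⁺ → proj₂ (∈-filter⁻ closed? {xs = candidates} r∈Ω⁺)) λ where
      c@(β , β∈L , p) →
        ∈-filter⁺ closed? (∈-cartesianProductWith⁺ _𝖱_ (path-source p) (path-target p)) c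
    where
    candidates = cartesianProductWith _𝖱_ (vars σ) (vars σ)

    closed? : ∀ r → Dec (Closure 𝔾 σ r)
    closed? r = em

  -- If both premises of a rule were provable, so would be `σ`; excluded middle on the first premise
  -- tells which one to follow.
  leftStep : ∀ f {σ} → Unprovable σ → f ∈ antecedent σ → Extension σ (DoneL f σ)
  leftStep (x ∶ ⊥ᶠ)     ⊬σ f∈Γ = _ , ⊬σ , ⊑-refl , tt
  leftStep (x ∶ atom p) ⊬σ f∈Γ = _ , ⊬σ , ⊑-refl , tt
  leftStep (x ∶ (φ ⇾ ψ)) {Ω ⊣ Γ ⇒ˢ Δ} ⊬σ f∈Γ with em {NCL[ 𝔾 ]⊢ Ω ⊣ Γ ⇒ˢ (x ∶ φ) ∷ Δ}
  ... | no ⊬₁  = _ , ⊬₁ , ⟨ id , id , there ⟩ , inj₁ (here refl)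
  ... | yes ⊢₁ = _ , (λ ⊢₂ → ⊬σ (contractL f∈Γ (⇾L ⊢₁ ⊢₂))) , ⟨ id , there , id ⟩ , inj₂ (here refl)
  leftStep (x ∶ (△ φ)) {Ω ⊣ Γ ⇒ˢ Δ} ⊬σ f∈Γ
    with em {NCL[ 𝔾 ]⊢ Ω ⊣ atSuccessors x φ Ω ++ (x ∶ △ φ) ∷ Γ ⇒ˢ Δ}
  ... | no ⊬₁  = _ , ⊬₁ , ⟨ id , ∈-++⁺ʳ _ ∘ there , id ⟩ , inj₁ (∈-++⁺ˡ ∘ atSuccessors⁺)
  ... | yes ⊢₁ = _ , (λ ⊢₂ → ⊬σ (contractL f∈Γ (△L ⊢₁ ⊢₂))) ,
                 ⟨ id , there , ∈-++⁺ʳ _ ⟩ , inj₂ (∈-++⁺ˡ ∘ atSuccessors⁺)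

  rightStep : ∀ f {σ} → Unprovable σ → f ∈ succedent σ → Extension σ (DoneR f)
  rightStep (x ∶ ⊥ᶠ)     ⊬σ f∈Δ = _ , ⊬σ , ⊑-refl , tt
  rightStep (x ∶ atom p) ⊬σ f∈Δ = _ , ⊬σ , ⊑-refl , tt
  rightStep (x ∶ (φ ⇾ ψ)) ⊬σ f∈Δ =
    _ , (λ ⊢₁ → ⊬σ (contractR f∈Δ (⇾R ⊢₁))) , ⟨ id , there , there ⟩ , here refl , here refl
  rightStep (x ∶ (△ φ)) {Ω ⊣ Γ ⇒ˢ Δ} ⊬σ f∈Δ =
    _ ,
    (λ ⊢₁ → ⊬σ (contractR f∈Δ
      (△R (1+n≢n ∘ sym) (∉-above-max ≤-refl) (∉-above-max (n≤1+n _)) ⊢₁))) ,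
    ⟨ there ∘ there , there , there ∘ there ⟩ ,
    y , suc y , (here refl , here refl) , (there (here refl) , here refl)
    where
    -- Both `y` and `suc y` exceed every variable of the conclusion of `△R`, so they are fresh and
    -- distinct.
    y = suc (max 0 (vars (Ω ⊣ Γ ⇒ˢ (x ∶ △ φ) ∷ Δ)))

  taskStep : ∀ t {σ} → Unprovable σ → Extension σ (Done t σ)
  taskStep close {σ} ⊬σ with closedControl σ
  ... | Ω⁺ , Ω⁺⇔ = _ , (λ ⊢₁ → ⊬σ (r𝐆 Ω⁺⇔ ⊢₁)) ,
                   ⟨ (λ r∈Ω → Equivalence.from (Ω⁺⇔ _) (closure-⊇ σ r∈Ω)) , id , id ⟩ ,
                   λ c → Equivalence.from (Ω⁺⇔ _) c
  taskStep (left f) {σ} ⊬σ with em {f ∈ antecedent σ}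
  ... | no f∉Γ = _ , ⊬σ , ⊑-refl , λ f∈Γ → contradiction f∈Γ f∉Γ
  ... | yes f∈Γ with leftStep f ⊬σ f∈Γ
  ...   | τ , ⊬τ , σ⊑τ , d = τ , ⊬τ , σ⊑τ , λ _ → d
  taskStep (right f) {σ} ⊬σ with em {f ∈ succedent σ}
  ... | no f∉Δ = _ , ⊬σ , ⊑-refl , λ f∈Δ → contradiction f∈Δ f∉Δ
  ... | yes f∈Δ with rightStep f ⊬σ f∈Δ
  ...   | τ , ⊬τ , σ⊑τ , d = τ , ⊬τ , σ⊑τ , λ _ → d

  tasksStep : ∀ ts {σ} → Unprovable σ → Extension σ (λ τ → All (λ t → Done t σ τ) ts)
  tasksStep [] ⊬σ = _ , ⊬σ , ⊑-refl , []
  tasksStep (t ∷ ts) ⊬σ with taskStep t ⊬σ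
  ... | τ , ⊬τ , σ⊑τ , d with tasksStep ts ⊬τ
  ...   | υ , ⊬υ , τ⊑υ , ds =
    υ , ⊬υ , ⊑-trans σ⊑τ τ⊑υ ,
    -- The first task stays done in the larger `υ`; the others were done for `τ`, hence also for the
    -- smaller `σ`.
    Done-mono t ⊑-refl τ⊑υ d ∷ All.map (λ {t} → Done-mono t σ⊑τ ⊑-refl) ds

  AllDone : Rel Sequent 0ℓ
  AllDone σ τ = ∀ t → Done t σ τ

  -- Tasks for formulae absent from `σ` hold vacuously, so a finite list of tasks covers all of
  -- them.
  fullStep : ∀ {σ} → Unprovable σ → Extension σ (AllDone σ)
  fullStep {σ} ⊬σ
    with tasksStep (close ∷ map left (antecedent σ) ++ map right (succedent σ)) ⊬σ
  ... | τ , ⊬τ , σ⊑τ , d ∷ ds = τ , ⊬τ , σ⊑τ , λ where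
    close         → d
    (left f)  f∈Γ → lookup ds (∈-++⁺ˡ (∈-map⁺ left f∈Γ)) f∈Γ
    (right f) f∈Δ → lookup ds (∈-++⁺ʳ _ (∈-map⁺ right f∈Δ)) f∈Δ

  -- The countermodel

  module _ (σ₀ : Sequent) (⊬σ₀ : Unprovable σ₀) where

    chain : ℕ → ∃ Unprovable
    chain zero    = σ₀ , ⊬σ₀
    chain (suc n) with fullStep (proj₂ (chain n))
    ... | τ , ⊬τ , _ = τ , ⊬τ

    stage : ℕ → Sequent
    stage n = proj₁ (chain n)

    stage-⊑suc : ∀ n → stage n ⊑ stage (suc n)
    stage-⊑suc n = proj₁ (proj₂ (proj₂ (fullStep (proj₂ (chain n)))))

    stage-done : ∀ n → AllDone (stage n) (stage (suc n))
    stage-done n = proj₂ (proj₂ (proj₂ (fullStep (proj₂ (chain n)))))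

    stage-mono : ∀ {m n} → m ≤ n → stage m ⊑ stage n
    stage-mono = mono′ ∘ ≤⇒≤′
      where
      mono′ : ∀ {m n} → m ≤′ n → stage m ⊑ stage n
      mono′ ≤′-refl            = ⊑-refl
      mono′ (≤′-step {n} m≤′n) = ⊑-trans (mono′ m≤′n) (stage-⊑suc n)

    ⊑-⊔ˡ : ∀ m n → stage m ⊑ stage (m ⊔ n)
    ⊑-⊔ˡ m n = stage-mono (m≤m⊔n m n)

    ⊑-⊔ʳ : ∀ m n → stage n ⊑ stage (m ⊔ n)
    ⊑-⊔ʳ m n = stage-mono (m≤n⊔m m n)

    R∞ : Rel Var 0ℓ
    R∞ u v = ∃ λ n → (u 𝖱 v) ∈ control (stage n)

    Γ∞ Δ∞ : Pred LFormula 0ℓ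
    Γ∞ f = ∃ λ n → f ∈ antecedent (stage n)
    Δ∞ f = ∃ λ n → f ∈ succedent (stage n)

    Occurs : Pred Var 0ℓ
    Occurs u = ∃ λ n → u ∈ vars (stage n)

    -- A common later stage would contain the formula on both sides and so be initial, hence
    -- provable.
    Γ∞Δ∞-disjoint : ∀ {f} → Γ∞ f → ¬ Δ∞ f
    Γ∞Δ∞-disjoint (m , f∈Γ) (n , f∈Δ) =
      proj₂ (chain (m ⊔ n))
        (contractL (antecedent-⊆ (⊑-⊔ˡ m n) f∈Γ) (contractR (succedent-⊆ (⊑-⊔ʳ m n) f∈Δ) init))

    ⊥∉Γ∞ : ∀ {x} → ¬ Γ∞ (x ∶ ⊥ᶠ)
    ⊥∉Γ∞ (n , f∈Γ) = proj₂ (chain n) (contractL f∈Γ init⊥)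

    path-at-stage : ∀ {β u v} → PathAlong Occurs R∞ β u v →
                    ∃ λ n →
                    PathAlong (_∈ vars (stage n)) (λ a b → (a 𝖱 b) ∈ control (stage n)) β u v
    -- The empty path has no atom to supply a stage; the stage comes from its point occurring in the
    -- limit.
    path-at-stage (nil (n , u∈)) = n , nil u∈
    path-at-stage (cons {z = z} _ s p) with z | s | path-at-stage p
    ... | fwd | m , s | n , p =
      m ⊔ n , cons (source∈vars (stage (m ⊔ n)) s′) s′
                   (path-map (vars-mono (⊑-⊔ʳ m n)) (control-⊆ (⊑-⊔ʳ m n)) p)
      where s′ = control-⊆ (⊑-⊔ˡ m n) s
    ... | bwd | m , s | n , p =
      m ⊔ n , cons (target∈vars (stage (m ⊔ n)) s′) s′
                   (path-map (vars-mono (⊑-⊔ʳ m n)) (control-⊆ (⊑-⊔ʳ m n)) p)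
      where s′ = control-⊆ (⊑-⊔ˡ m n) s

    -- The worlds are all the variables, so that the assignment can be the
    -- identity; those not occurring in the limit form a separate cluster.
    countermodel : Model
    countermodel = record
      { frame = record
        { W        = Var
        ; nonempty = 0
        ; R        = λ u v → R∞ u v ⊎ (¬ Occurs u × ¬ Occurs v)
        }
      ; V = λ u p → Γ∞ (u ∶ atom p)
      }

    open Model countermodel using (R; frame)

    -- Path conditions in the countermodel.

    R∞-source : ∀ {u v} → R∞ u v → Occurs u
    R∞-source (n , r∈Ω) = n , source∈vars (stage n) r∈Ω

    R∞-target : ∀ {u v} → R∞ u v → Occurs v
    R∞-target (n , r∈Ω) = n , target∈vars (stage n) r∈Ω

    -- No edge of `R` joins an occurring variable to a non-occurring one, so a path stays on one
    -- side. Outside the limit all pairs are related, so only the two ends need recording.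
    path-split : ∀ {β u v} → PathAlong U R β u v →
                 PathAlong Occurs R∞ β u v ⊎ (¬ Occurs u × ¬ Occurs v)
    path-split (nil {u} _) with em {Occurs u}
    ... | yes u∈ = inj₁ (nil u∈)
    ... | no u∉  = inj₂ (u∉ , u∉)
    path-split (cons {z = z} _ s p) with z | s | path-split p
    ... | fwd | inj₁ s         | inj₁ p         = inj₁ (cons (R∞-source s) s p)
    ... | bwd | inj₁ s         | inj₁ p         = inj₁ (cons (R∞-target s) s p)
    ... | fwd | inj₁ s         | inj₂ (b∉ , _)  = contradiction (R∞-target s) b∉
    ... | bwd | inj₁ s         | inj₂ (b∉ , _)  = contradiction (R∞-source s) b∉
    ... | fwd | inj₂ (_ , b∉)  | inj₁ p         = contradiction (path-source p) b∉
    ... | bwd | inj₂ (b∉ , _)  | inj₁ p         = contradiction (path-source p) b∉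
    ... | fwd | inj₂ (a∉ , _)  | inj₂ (_ , c∉)  = inj₂ (a∉ , c∉)
    ... | bwd | inj₂ (_ , a∉)  | inj₂ (_ , c∉)  = inj₂ (a∉ , c∉)

    frame-satisfies : GFrame 𝔾 frame
    frame-satisfies = tabulate λ g∈𝔾 β β∈L p →
      -- A pair of ends outside the limit is already an edge of the cluster, so only paths in the
      -- limit have to be closed.
      Sum.map₁ (close-path (language-𝔾 g∈𝔾 β∈L)) (path-split p)
      where
      close-path : ∀ {β u v} → Language (SystemOf 𝔾) [ fwd ] β → PathAlong Occurs R∞ β u v → R∞ u v
      close-path β∈L p with path-at-stage p
      ... | n , q = suc n , stage-done n close (_ , β∈L , q)

    -- △L is applied anew at every stage, possibly with another premise; only for
    -- successors present at the same stage is the side known to be the same.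
    △-pairwise : ∀ {u φ v w} → Γ∞ (u ∶ △ φ) → R∞ u v → R∞ u w →
                 (Γ∞ (v ∶ φ) × Γ∞ (w ∶ φ)) ⊎ (Δ∞ (v ∶ φ) × Δ∞ (w ∶ φ))
    △-pairwise {u} {φ} (k , △φ∈Γ) (m , uRv) (n , uRw) =
      Sum.map (λ h → (suc l , h uRv′) , (suc l , h uRw′)) (λ h → (suc l , h uRv′) , (suc l , h uRw′))
              (stage-done l (left (u ∶ (△ φ))) (antecedent-⊆ (⊑-⊔ˡ k _) △φ∈Γ))
      where
      l = k ⊔ (m ⊔ n)
      uRv′ = control-⊆ (⊑-trans (⊑-⊔ˡ m n) (⊑-⊔ʳ k (m ⊔ n))) uRv
      uRw′ = control-⊆ (⊑-trans (⊑-⊔ʳ m n) (⊑-⊔ʳ k (m ⊔ n))) uRw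

    -- A successor with `φ` in `Γ∞` forces every other successor onto its side, by pairing and
    -- disjointness. If there is none, pairing each successor with itself puts it in `Δ∞`.
    △-uniform : ∀ {u φ} → Γ∞ (u ∶ △ φ) →
                (∀ {v} → R∞ u v → Γ∞ (v ∶ φ)) ⊎ (∀ {v} → R∞ u v → Δ∞ (v ∶ φ))
    △-uniform {u} {φ} △φ∈Γ with em {∃ λ w → R∞ u w × Γ∞ (w ∶ φ)}
    ... | yes (w , uRw , w∈Γ) = inj₁ λ uRv → case △-pairwise △φ∈Γ uRv uRw of λ where
      (inj₁ (v∈Γ , _)) → v∈Γ
      (inj₂ (_ , w∈Δ)) → contradiction w∈Δ (Γ∞Δ∞-disjoint w∈Γ)
    ... | no ∄w = inj₂ λ uRv → case △-pairwise △φ∈Γ uRv uRv of λ where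
      (inj₁ (v∈Γ , _)) → contradiction (_ , uRv , v∈Γ) ∄w
      (inj₂ (v∈Δ , _)) → v∈Δ

    -- Truth lemma for the limit.

    R⇒R∞ : ∀ {u v} → Occurs u → R u v → R∞ u v
    R⇒R∞ u∈ (inj₁ uRv)      = uRv
    R⇒R∞ u∈ (inj₂ (u∉ , _)) = contradiction u∈ u∉

    mutual
      -- Induction on the formula, simultaneous for both sides because implication and `△` switch
      -- between them. The label of a `△` formula occurs, so its successors are not in the extra
      -- cluster.
      Γ∞-true : ∀ φ {u} → Γ∞ (u ∶ φ) → countermodel , u ⊨ φ
      Γ∞-true ⊥ᶠ       ⊥∈Γ = ⊥∉Γ∞ ⊥∈Γ
      Γ∞-true (atom p) p∈Γ = p∈Γ
      Γ∞-true (φ ⇾ ψ) {u} (n , f∈Γ) u⊨φ with stage-done n (left (u ∶ (φ ⇾ ψ))) f∈Γ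
      ... | inj₁ φ∈Δ = contradiction u⊨φ (Δ∞-false φ (suc n , φ∈Δ))
      ... | inj₂ ψ∈Γ = Γ∞-true ψ (suc n , ψ∈Γ)
      Γ∞-true (△ φ) {u} △φ∈Γ@(n , f∈Γ) =
        Sum.map (λ h v uRv → Γ∞-true φ (h (R⇒R∞ u∈ uRv)))
                (λ h v uRv → Δ∞-false φ (h (R⇒R∞ u∈ uRv)))
                (△-uniform △φ∈Γ)
        where u∈ = n , antecedent∈vars (stage n) f∈Γ

      Δ∞-false : ∀ φ {u} → Δ∞ (u ∶ φ) → ¬ (countermodel , u ⊨ φ)
      Δ∞-false ⊥ᶠ       ⊥∈Δ = id
      Δ∞-false (atom p) p∈Δ p∈Γ = Γ∞Δ∞-disjoint p∈Γ p∈Δ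
      Δ∞-false (φ ⇾ ψ) {u} (n , f∈Δ) u⊨φ⇾ψ with stage-done n (right (u ∶ (φ ⇾ ψ))) f∈Δ
      ... | φ∈Γ , ψ∈Δ = Δ∞-false ψ (suc n , ψ∈Δ) (u⊨φ⇾ψ (Γ∞-true φ (suc n , φ∈Γ)))
      -- The witnesses from `△R` refute the two alternatives: `φ` fails at `z` and holds at `y`.
      Δ∞-false (△ φ) {u} (n , f∈Δ) u⊨△φ with stage-done n (right (u ∶ (△ φ))) f∈Δ | u⊨△φ
      ... | y , z , _ , (uRz , z∈Δ) | inj₁ all⊨ =
        Δ∞-false φ (suc n , z∈Δ) (all⊨ z (inj₁ (suc n , uRz)))
      ... | y , z , (uRy , y∈Γ) , _ | inj₂ all⊭ =
        all⊭ y (inj₁ (suc n , uRy)) (Γ∞-true φ (suc n , y∈Γ))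

    not-valid : ¬ ValidOver (GFrame 𝔾) σ₀
    not-valid valid
      with find (valid countermodel frame-satisfies id
                   -- Stage `0` is `σ₀` itself.
                   (tabulate λ r∈Ω → inj₁ (0 , r∈Ω)) (tabulate λ f∈Γ → Γ∞-true _ (0 , f∈Γ)))
    ... | (u ∶ φ) , f∈Δ , u⊨φ = Δ∞-false φ (0 , f∈Δ) u⊨φ

mainTheorem2 : ExcludedMiddle 0ℓ → (𝔾 : List GPC) (σ : Sequent) → ValidOver (GFrame 𝔾) σ → NCL[ 𝔾 ]⊢ σ
mainTheorem2 em 𝔾 σ valid = decidable-stable em λ ⊬σ → not-valid em 𝔾 σ ⊬σ valid
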